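{- Let $G=(V,E)$ be a control flow graph, let $p$ be a predicate node with successors $s_1,s_2$ in $G$ and with at least two successors in $A_p$. Assume $V_1\cap V_2=\emptyset$ and let $U=V_p\setminus(V_1\cup V_2)$. Then there exist nodes $a,b$ that are DOD on $p$ if and only if the cycle $C$ of $A_p$ has an unfolding belonging to the language $V_1.U^*.(V_2.U^*)^*.V_2.U^*.(V_1.U^*)^*$.
   Context: A control flow graph (CFG) is a finite directed graph $G=(V,E)$ in which every node has at most two outgoing edges; nodes with exactly two outgoing edges are predicate nodes. A path from $n_1$ is a nonempty finite or infinite sequence of nodes with each adjacent pair an edge; it is maximal if it is infinite or its last node has no successor. $V_p$ is the set of nodes occurring on all maximal paths from $p$ in $G$. For $V'\subseteq V$, a $V'$-interval from $x$ to $y$ is a finite path $n_1\ldots n_k$ in $G$ with $k\ge 2$, $n_1=x\in V'$, $n_k=y\in V'$, and $n_i\notin V'$ for $1<i<k$. $A_p$ is the directed graph with node set $V_p$ and an edge $(x,y)$ iff there is a $V_p$-interval from $x$ to $y$ in $G$. The cycle $C$ of $A_p$ is the subgraph of $A_p$ induced by $V_p\setminus\{p\}$; an unfolding of $C$ is a path in $C$ containing each node of $C$ exactly once, viewed as a word over the alphabet $V_p$. For $i\in\{1,2\}$, $V_i$ is the set of nodes $n\in V_p$ such that there is a finite path in $G$ from $s_i$ to $n$ whose nodes other than the last one all lie outside $V_p$ (possibly $n=s_i$). For three distinct nodes $p,a,b$ with $p$ a predicate node with successors $s_1,s_2$, the nodes $a,b$ are DOD on $p$ if all maximal paths from $p$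 contain both $a$ and $b$, all maximal paths from $s_1$ contain $a$ before any occurrence of $b$, and all maximal paths from $s_2$ contain $b$ before any occurrence of $a$. Concatenation and Kleene star of sets of nodes are the usual regular-language operations. -}

module Defs where

open import Data.Fin.Base using (Fin; toℕ)
open import Data.Fin.Subset using (Subset; ∣_∣) renaming (_∈_ to _∈ˢ_)
open import Data.List.Base using (List; []; _∷_; [_]; _++_; concat; length; lookup)
  renaming (_∷ʳ_ to _∷ʳˡ_)
open import Data.List.Membership.Propositional using () renaming (_∈_ to _∈ˡ_)
open import Data.List.NonEmpty.Base using (List⁺; _∷_; _∷ʳ_; head; last; toList)
open import Data.List.Relation.Unary.All using (All)
open import Data.List.Relation.Unary.Linked using (Linked)
open import Data.List.Relation.Unary.Unique.Propositional using (Unique)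
open import Data.Nat.Base using (ℕ; suc; _≤_; _<_)
open import Data.Product.Base using (_×_; ∃; ∃₂)
open import Data.Unit.Base using (⊤)
open import Level using (0ℓ)
open import Relation.Binary.Core using (Rel)
open import Relation.Binary.PropositionalEquality.Core using (_≡_; _≢_)
open import Relation.Nullary.Negation.Core using (¬_)
open import Relation.Unary using (Pred; _∈_; _∉_; _∩_; _∖_; ｛_｝)

Language : Set → Set₁
Language A = Pred (List A) 0ℓ

module _ {A : Set} where

  infix  9 _⋆
  infixr 8 _·_

  -- A set of letters as a language of one-letter words.
  ⟦_⟧ : Pred A 0ℓ → Language A
  ⟦ P ⟧ w = ∃ λ a → a ∈ P × w ≡ [ a ]

  _·_ : Language A → Language A → Language A
  (L · M) w = ∃₂ λ u v → u ∈ L × v ∈ M × w ≡ u ++ v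

  _⋆ : Language A → Language A
  (L ⋆) w = ∃ λ us → All L us × w ≡ concat us

record Digraph (A : Set) : Set₁ where
  field
    nodes : Pred A 0ℓ
    edges : Rel A 0ℓ

open Digraph public

induced : {A : Set} → Digraph A → Pred A 0ℓ → Digraph A
induced D P = record
  { nodes = nodes D ∩ P
  ; edges = λ x y → x ∈ P × y ∈ P × edges D x y
  }

Unfolding : {A : Set} → Digraph A → List⁺ A → Set
Unfolding D ns =
    All (nodes D) (toList ns)
  × Linked (edges D) (toList ns)
  × Unique (toList ns)
  × (∀ v → v ∈ nodes D → v ∈ˡ toList ns)

data Sequence (A : Set) : Set where
  finite   : List⁺ A → Sequence A
  infinite : (ℕ → A) → Sequence A

module _ {A : Set} where

  infix 4 _[_]=_

  first : Sequence A → A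
  first (finite ns)  = head ns
  first (infinite f) = f 0

  -- π [ i ]= v : position i, counted from 0, exists in π and carries v.
  _[_]=_ : Sequence A → ℕ → A → Set
  finite ns  [ i ]= v = ∃ λ (j : Fin (length (toList ns))) →
                          toℕ j ≡ i × lookup (toList ns) j ≡ v
  infinite f [ i ]= v = f i ≡ v

  OccursIn : A → Sequence A → Set
  OccursIn v π = ∃ λ i → π [ i ]= v

  -- a occurs in π, and some occurrence of it precedes every occurrence of b.
  Before : A → A → Sequence A → Set
  Before a b π = ∃ λ i → π [ i ]= a × (∀ j → π [ j ]= b → i < j)

record CFG : Set where
  field
    size       : ℕ
    successors : Fin size → Subset size
    outdegree  : ∀ v → ∣ successors v ∣ ≤ 2

  Node : Set
  Node = Fin size

  infix 4 _⟶_

  _⟶_ : Rel Node 0ℓ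
  x ⟶ y = y ∈ˢ successors x

open CFG public using (Node)

module _ (G : CFG) where

  open CFG G using (successors; _⟶_)

  IsPath : Sequence (Node G) → Set
  IsPath (finite ns)  = Linked _⟶_ (toList ns)
  IsPath (infinite f) = ∀ i → f i ⟶ f (suc i)

  IsMaximal : Sequence (Node G) → Set
  IsMaximal (finite ns)  = ∀ v → ¬ (last ns ⟶ v)
  IsMaximal (infinite _) = ⊤

  AllMaximalPathsFrom : Node G → Pred (Sequence (Node G)) 0ℓ → Set
  AllMaximalPathsFrom n Q = ∀ π → IsPath π → IsMaximal π → first π ≡ n → Q π

  PredicateNode : (p s₁ s₂ : Node G) → Set
  PredicateNode p s₁ s₂ = ∣ successors p ∣ ≡ 2 × p ⟶ s₁ × p ⟶ s₂ × s₁ ≢ s₂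

  V[_] : Node G → Pred (Node G) 0ℓ
  V[ p ] v = AllMaximalPathsFrom p (OccursIn v)

  -- ms lists the inner nodes of the path, so its length k is at least 2.
  Interval : Pred (Node G) 0ℓ → Rel (Node G) 0ℓ
  Interval V′ x y =
    x ∈ V′ × y ∈ V′ ×
    ∃ λ ms → IsPath (finite (x ∷ (ms ∷ʳˡ y))) × All (_∉ V′) ms

  A[_] : Node G → Digraph (Node G)
  A[ p ] = record
    { nodes = V[ p ]
    ; edges = Interval V[ p ]
    }

  -- Named a cycle because it is one whenever p has two successors in A_p;
  -- by definition it is just an induced subgraph.
  C[_] : Node G → Digraph (Node G)
  C[ p ] = induced A[ p ] (V[ p ] ∖ ｛ p ｝)

  -- For s = s_i this is the set V_i; n = s is the case ms = [].
  FirstHit : (p s : Node G) → Pred (Node G) 0ℓ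
  FirstHit p s n =
    n ∈ V[ p ] ×
    ∃ λ ms → IsPath (finite (ms ∷ʳ n)) × head (ms ∷ʳ n) ≡ s × All (_∉ V[ p ]) ms

  record DOD (p s₁ s₂ a b : Node G) : Set where
    field
      p≢a     : p ≢ a
      p≢b     : p ≢ b
      a≢b     : a ≢ b
      branch  : PredicateNode p s₁ s₂
      both    : AllMaximalPathsFrom p (λ π → OccursIn a π × OccursIn b π)
      a-first : AllMaximalPathsFrom s₁ (Before a b)
      b-first : AllMaximalPathsFrom s₂ (Before b a)

-- Let x and y be two A_p-successors of p. A maximal path from p through x must still meet y and
-- conversely, so every path from p is infinite and meets each node of V_p other than p infinitely
-- often. Branching of A_p at such a node, or a return to p, would allow a path that misses some
-- node of V_p; hence A_p restricted to V_p without p is a single directed cycle, and its unfoldings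
-- are its rotations. If a, b are DOD on p, then the arc after a up to b contains no node of V₁ and
-- the arc after b up to a none of V₂; rotating the cycle to start at the last V₁-node of the second
-- arc gives the word. Conversely, the first letter of the word and its last letter in V₂ are DOD.
-- Path quantifiers are handled through inductive "until" predicates, which on a finite graph are
-- decidable and agree with the quantification over all maximal paths.
module Submission where

open import Defs
open import Data.Empty using (⊥; ⊥-elim)
open import Data.Fin.Base using (Fin; zero; suc; toℕ)
open import Data.Fin.Properties using (any?; all?; toℕ-injective) renaming (_≟_ to _≟ᶠ_)
open import Data.Fin.Subset using (Subset; ⁅_⁆; _⊃_) renaming (_∈_ to _∈ˢ_; _∪_ to _∪ˢ_; ⊥ to ∅)
open import Data.Fin.Subset.Induction using (⊃-wellFounded; Acc; acc)
open import Data.Fin.Subset.Properties using (_∈?_; ∉⊥; x∈⁅x⁆; x∈⁅y⁆⇒x≡y; p⊆p∪q; q⊆p∪q; x∈p∪q⁻)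
open import Data.List.Base using (List; []; _∷_; [_]; _++_; length; lookup; initLast; _∷ʳ′_) renaming (_∷ʳ_ to _∷ʳˡ_)
open import Data.List.Membership.Propositional using (lose) renaming (_∈_ to _∈ˡ_; _∉_ to _∉ˡ_)
open import Data.List.Membership.Propositional.Properties using (∈-∃++; ∈-++⁺ˡ; ∈-++⁺ʳ; ∈-++⁻)
open import Data.List.NonEmpty.Base using (_∷_; _∷ʳ_; toList; head; last)
open import Data.List.Properties using (++-assoc)
open import Data.List.Relation.Binary.Permutation.Propositional using (↭⇒↭ₛ)
open import Data.List.Relation.Binary.Permutation.Propositional.Properties using (++-comm)
import Data.List.Relation.Binary.Permutation.Setoid.Properties as Permutationₛ
open import Data.List.Relation.Unary.All as All using (All; []; _∷_)
import Data.List.Relation.Unary.All.Properties as All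
open import Data.List.Relation.Unary.AllPairs as AllPairs using ([]; _∷_)
open import Data.List.Relation.Unary.Any as Any using (Any; here; there)
open import Data.List.Relation.Unary.Linked as Linked using (Linked; []; [-]; _∷_)
open import Data.List.Relation.Unary.Unique.Propositional using (Unique)
open import Data.Nat.Base using (ℕ; zero; suc; _<_; _≤_; s≤s)
open import Data.Nat.Properties using (<-asym; <-cmp; <⇒≤; ≤-refl)
open import Data.Product.Base using (_×_; _,_; ∃; ∃₂; proj₁; proj₂; map₂)
open import Data.Sum.Base using (_⊎_; inj₁; inj₂; [_,_]′)
open import Data.Unit.Base using (tt)
open import Function.Base using (_∘_)
open import Function.Bundles using (_⇔_; mk⇔)
open import Level using (0ℓ)
open import Relation.Binary.Construct.Closure.ReflexiveTransitive using (Star; ε; _◅_; _◅◅_)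
open import Relation.Binary.Core using (Rel)
open import Relation.Binary.Definitions using (tri<; tri≈; tri>) renaming (Decidable to Decidable₂)
open import Relation.Binary.PropositionalEquality using (_≡_; _≢_; refl; sym; trans; subst; cong; ≢-sym; setoid)
open import Relation.Nullary.Decidable using (yes; no; map′; _×-dec_; _⊎-dec_; _→-dec_; ¬?; decidable-stable)
open import Relation.Nullary.Negation using (¬_; contradiction)
open import Relation.Unary using (Pred; _∈_; _∉_; _⊆_; _∪_; _∩_; _∖_; Empty; Decidable) renaming (U to Always)

-- Until operators on finite graphs, decided as least fixed points.

module _ {n} (F : Subset n → Pred (Fin n) 0ℓ) (F? : ∀ S → Decidable (F S))
         {Good : Pred (Fin n) 0ℓ}
         (F-sound : ∀ S → (_∈ˢ S) ⊆ Good → F S ⊆ Good) where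

  -- Opaque, so that terms depending on the search do not unfold in with-abstractions.
  abstract
    saturate : ∃ λ S → (_∈ˢ S) ⊆ Good × F S ⊆ (_∈ˢ S)
    saturate = go ∅ (λ x∈∅ → contradiction x∈∅ ∉⊥) (⊃-wellFounded ∅)
      where
      go : ∀ S → (_∈ˢ S) ⊆ Good → Acc _⊃_ S → ∃ λ T → (_∈ˢ T) ⊆ Good × F T ⊆ (_∈ˢ T)
      go S S⊆Good (acc rec) with any? (λ x → F? S x ×-dec ¬? (x ∈? S))
      ... | no closed = S , S⊆Good ,
        λ {x} Fx → decidable-stable (x ∈? S) (λ x∉S → closed (x , Fx , x∉S))
      -- Each round adds a single new element, so strict reverse inclusion, well-founded on subsets
      -- of a finite set, bounds the search.
      ... | yes (x , Fx , x∉S) = go (S ∪ˢ ⁅ x ⁆) S′⊆Good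
          (rec (p⊆p∪q ⁅ x ⁆ , x , q⊆p∪q S ⁅ x ⁆ (x∈⁅x⁆ x) , x∉S))
        where
        S′⊆Good : (_∈ˢ (S ∪ˢ ⁅ x ⁆)) ⊆ Good
        S′⊆Good y∈ with x∈p∪q⁻ S ⁅ x ⁆ y∈
        ... | inj₁ y∈S = S⊆Good y∈S
        ... | inj₂ y∈x = subst Good (sym (x∈⁅y⁆⇒x≡y x y∈x)) (F-sound S S⊆Good Fx)

module _ {A : Set} (_⟶_ : Rel A 0ℓ) (Q P : Pred A 0ℓ) where

  -- The path quantifiers E[Q U P] and A[Q U P] of computation tree logic.
  data EU : Pred A 0ℓ where
    here : ∀ {x} → P x → EU x
    step : ∀ {x y} → Q x → x ⟶ y → EU y → EU x

  data AU : Pred A 0ℓ where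
    here : ∀ {x} → P x → AU x
    -- The successor excludes sinks: there the last premise holds vacuously, although the one-node
    -- maximal path need not meet `P`.
    step : ∀ {x} → Q x → ∃ (x ⟶_) → (∀ {y} → x ⟶ y → AU y) → AU x

module _ {n} {_⟶_ : Rel (Fin n) 0ℓ} (_⟶?_ : Decidable₂ _⟶_)
         {Q P : Pred (Fin n) 0ℓ} (Q? : Decidable Q) (P? : Decidable P) where

  -- `EU` is the least fixed point of `F`: soundness keeps the saturated set inside `EU`, and
  -- closure makes it absorb every derivation by induction. `AU?` works alike.
  EU? : Decidable (EU _⟶_ Q P)
  EU? x with saturate F F? F-sound
    where
    F : Subset n → Pred (Fin n) 0ℓ
    F S x = P x ⊎ Q x × ∃ λ y → x ⟶ y × y ∈ˢ S

    F? : ∀ S → Decidable (F S)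
    F? S x = P? x ⊎-dec (Q? x ×-dec any? λ y → (x ⟶? y) ×-dec (y ∈? S))

    F-sound : ∀ S → (_∈ˢ S) ⊆ EU _⟶_ Q P → F S ⊆ EU _⟶_ Q P
    F-sound S sound (inj₁ Px)                  = here Px
    F-sound S sound (inj₂ (Qx , _ , x⟶y , y∈S)) = step Qx x⟶y (sound y∈S)
  ... | S , sound , closed = map′ sound complete (x ∈? S)
    where
    complete : EU _⟶_ Q P ⊆ (_∈ˢ S)
    complete (here Px)        = closed (inj₁ Px)
    complete (step Qx x⟶y ey) = closed (inj₂ (Qx , _ , x⟶y , complete ey))

  AU? : Decidable (AU _⟶_ Q P)
  AU? x with saturate F F? F-sound
    where
    F : Subset n → Pred (Fin n) 0ℓ
    F S x = P x ⊎ Q x × ∃ (x ⟶_) × (∀ y → x ⟶ y → y ∈ˢ S)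

    F? : ∀ S → Decidable (F S)
    F? S x = P? x ⊎-dec (Q? x ×-dec any? (x ⟶?_) ×-dec all? λ y → (x ⟶? y) →-dec (y ∈? S))

    F-sound : ∀ S → (_∈ˢ S) ⊆ AU _⟶_ Q P → F S ⊆ AU _⟶_ Q P
    F-sound S sound (inj₁ Px)              = here Px
    F-sound S sound (inj₂ (Qx , live , f)) = step Qx live (λ x⟶y → sound (f _ x⟶y))
  ... | S , sound , closed = map′ sound complete (x ∈? S)
    where
    complete : AU _⟶_ Q P ⊆ (_∈ˢ S)
    complete (here Px)        = closed (inj₁ Px)
    complete (step Qx live f) = closed (inj₂ (Qx , live , λ _ x⟶y → complete (f x⟶y)))

-- Positions in sequences and the until property.

module _ {A : Set} where

  at-functional : ∀ (π : Sequence A) {i u v} → π [ i ]= u → π [ i ]= v → u ≡ v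
  at-functional (finite ns) (j , refl , refl) (k , eq , refl) =
    cong (lookup (toList ns)) (sym (toℕ-injective eq))
  at-functional (infinite f) refl refl = refl

  first-at : ∀ (π : Sequence A) → π [ 0 ]= first π
  first-at (finite (x ∷ xs)) = zero , refl , refl
  first-at (infinite f)      = refl

  at-first : ∀ (π : Sequence A) {v} → π [ 0 ]= v → v ≡ first π
  at-first π at = at-functional π at (first-at π)

  at-∷⁺ : ∀ {x y v : A} {ys i} → finite (y ∷ ys) [ i ]= v → finite (x ∷ y ∷ ys) [ suc i ]= v
  at-∷⁺ (j , refl , eq) = suc j , refl , eq

  at-∷⁻ : ∀ {x y v : A} {ys i} → finite (x ∷ y ∷ ys) [ suc i ]= v → finite (y ∷ ys) [ i ]= v
  at-∷⁻ (suc j , refl , eq) = j , refl , eq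

  last-∷ : ∀ (x y : A) ys → last (x ∷ y ∷ ys) ≡ last (y ∷ ys)
  last-∷ x y ys with initLast ys
  ... | []      = refl
  ... | _ ∷ʳ′ _ = refl

  Walk : Rel A 0ℓ → Sequence A → Set
  Walk R (finite ns)  = Linked R (toList ns)
  Walk R (infinite f) = ∀ i → R (f i) (f (suc i))

  walk-pred : ∀ {R : Rel A 0ℓ} π {i v} → Walk R π → π [ suc i ]= v → ∃ λ u → π [ i ]= u × R u v
  walk-pred {R} (finite (x ∷ xs)) linked (suc j , refl , refl) = go linked j
    where
    go : ∀ {x xs} → Linked R (x ∷ xs) → (j : Fin (length xs)) →
         ∃ λ u → finite (x ∷ xs) [ toℕ j ]= u × R u (lookup xs j)
    go (Rxy ∷ _)            zero    = _ , (zero , refl , refl) , Rxy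
    go {xs = _ ∷ _} (_ ∷ l) (suc j) = map₂ (λ (at , R) → at-∷⁺ at , R) (go l j)
  walk-pred (infinite f) walk refl = _ , refl , walk _

  Until : (Q P : Pred A 0ℓ) → Pred (Sequence A) 0ℓ
  Until Q P π = ∃₂ λ i v → π [ i ]= v × P v × (∀ {j u} → j < i → π [ j ]= u → Q u)

  until-here : ∀ {Q P : Pred A 0ℓ} π {v} → first π ≡ v → P v → Until Q P π
  until-here π refl Pv = 0 , _ , first-at π , Pv , λ ()

  occurs⇒until : ∀ π {v} → OccursIn v π → Until Always (_≡ v) π
  occurs⇒until π (i , at) = i , _ , at , refl , _

  until⇒occurs : ∀ π {Q : Pred A 0ℓ} {v} → Until Q (_≡ v) π → OccursIn v π
  until⇒occurs π (i , _ , at , refl , _) = i , at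

  before⇒until : ∀ π {a b} → Before a b π → Until (_≢ b) (_≡ a) π
  before⇒until π (i , at , first-a) =
    i , _ , at , refl , λ j<i atⱼ → λ { refl → <-asym (first-a _ atⱼ) j<i }

  until⇒before : ∀ π {a b} → a ≢ b → Until (_≢ b) (_≡ a) π → Before a b π
  until⇒before π {b = b} a≢b (i , _ , at , refl , avoids) = i , at , later
    where
    later : ∀ j → π [ j ]= b → i < j
    later j atⱼ with <-cmp i j
    ... | tri< i<j _ _  = i<j
    ... | tri≈ _ refl _ = contradiction (at-functional π at atⱼ) a≢b
    ... | tri> _ _ j<i  = contradiction refl (avoids j<i atⱼ)

-- Quantification over all maximal paths as an inductive predicate.

module _ (G : CFG) where

  open CFG G using (size; successors; _⟶_)

  _⟶?_ : Decidable₂ _⟶_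
  x ⟶? y = y ∈? successors x

  -- Recursion on the derivation consumes one node of the path per `step`; a maximal path cannot end
  -- at such a node, which has a successor.
  AU⇒until : ∀ {Q P x} → AU _⟶_ Q P x → AllMaximalPathsFrom G x (Until Q P)
  AU⇒until (here Px) π path maximal eq = until-here π eq Px
  AU⇒until (step Qx (y , x⟶y) f) (finite (x ∷ [])) path maximal refl =
    contradiction x⟶y (maximal y)
  AU⇒until {Q} {P} (step Qx _ f) (finite (x ∷ y ∷ ys)) (x⟶y ∷ path) maximal refl
    with AU⇒until (f x⟶y) (finite (y ∷ ys)) path
           (subst (λ z → ∀ v → ¬ (z ⟶ v)) (last-∷ x y ys) maximal) refl
  ... | i , v , at , Pv , before = suc i , v , at-∷⁺ at , Pv , before′
    where
    before′ : ∀ {j u} → j < suc i → finite (x ∷ y ∷ ys) [ j ]= u → Q u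
    before′ {zero}  _         at = subst Q (sym (at-first (finite (x ∷ y ∷ ys)) at)) Qx
    before′ {suc j} (s≤s j<i) at = before j<i (at-∷⁻ at)
  AU⇒until {Q} {P} (step Qx _ f) (infinite g) path maximal refl
    with AU⇒until (f (path 0)) (infinite (g ∘ suc)) (path ∘ suc) tt refl
  ... | i , v , at , Pv , before = suc i , v , at , Pv , before′
    where
    before′ : ∀ {j u} → j < suc i → g j ≡ u → Q u
    before′ {zero}  _         refl = Qx
    before′ {suc j} (s≤s j<i) at   = before j<i at

  module _ (τ : Node G → Node G) (τ-succ : ∀ {x y} → x ⟶ y → x ⟶ τ x) where

    Follow : Rel (Node G) 0ℓ
    Follow x y = x ⟶ y × y ≡ τ x

    Sink : Pred (Node G) 0ℓ
    Sink x = ∀ y → ¬ (x ⟶ y)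

    Halts : Pred (Node G) 0ℓ
    Halts = EU Follow Always Sink

    halts? : Decidable Halts
    halts? = EU? (λ x y → (x ⟶? y) ×-dec (y ≟ᶠ τ x)) (λ _ → yes tt)
                 (λ x → all? (λ y → ¬? (x ⟶? y)))

    halting-walk : ∀ {x} → Halts x → ∃ λ xs → Linked Follow (x ∷ xs) × Sink (last (x ∷ xs))
    halting-walk (here sink) = [] , [-] , sink
    halting-walk {x} (step {y = y} _ follow h) with halting-walk h
    ... | ys , linked , sink = y ∷ ys , follow ∷ linked , subst Sink (sym (last-∷ x y ys)) sink

    loop-forever : ∀ {x} → ¬ Halts x → ∃ λ f → (∀ i → Follow (f i) (f (suc i))) × f 0 ≡ x
    loop-forever {x} ¬halts = f , (λ i → follow (¬halts-f i)) , refl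
      where
      f : ℕ → Node G
      f zero    = x
      f (suc i) = τ (f i)

      follow : ∀ {y} → ¬ Halts y → Follow y (τ y)
      follow {y} ¬h with any? (y ⟶?_)
      ... | yes (_ , y⟶z) = τ-succ y⟶z , refl
      ... | no sink       = contradiction (here λ z y⟶z → sink (z , y⟶z)) ¬h

      ¬halts-f : ∀ i → ¬ Halts (f i)
      ¬halts-f zero    = ¬halts
      ¬halts-f (suc i) = λ h → ¬halts-f i (step tt (follow (¬halts-f i)) h)

    -- Iterating `τ` either reaches a sink or never does. Since `Halts` is decidable, the choice
    -- between a finite and an infinite sequence is constructive.
    maximal-walk : ∀ x → ∃ λ π → Walk Follow π × IsPath G π × IsMaximal G π × first π ≡ x
    maximal-walk x with halts? x
    ... | yes h = let xs , linked , sink = halting-walk h in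
      finite (x ∷ xs) , linked , Linked.map proj₁ linked , sink , refl
    ... | no ¬h = let f , follow , eq = loop-forever ¬h in
      infinite f , follow , proj₁ ∘ follow , tt , eq

  module _ {Q P : Pred (Node G) 0ℓ} (Q? : Decidable Q) (P? : Decidable P) where

    private
      au? : Decidable (AU _⟶_ Q P)
      au? = AU? _⟶?_ Q? P?

    -- A memoryless strategy for refuting `AU`: move to a successor outside `AU` whenever there is
    -- one.
    escape : Node G → Node G
    escape x with any? (λ y → (x ⟶? y) ×-dec ¬? (au? y))
    ... | yes (y , _) = y
    ... | no _ with any? (x ⟶?_)
    ...   | yes (y , _) = y
    -- Default at a sink; `Follow` demands an edge, so it never becomes a step of the walk.
    ...   | no _        = x

    escape-succ : ∀ {x y} → x ⟶ y → x ⟶ escape x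
    escape-succ {x} x⟶y with any? (λ y → (x ⟶? y) ×-dec ¬? (au? y))
    ... | yes (_ , x⟶z , _) = x⟶z
    ... | no _ with any? (x ⟶?_)
    ...   | yes (_ , x⟶z) = x⟶z
    ...   | no sink       = contradiction (_ , x⟶y) sink

    -- Were every successor of `x` in `AU`, the constructor `step` would put `x` there as well.
    escape-avoids : ∀ {x y} → ¬ AU _⟶_ Q P x → Q x → x ⟶ y → ¬ AU _⟶_ Q P (escape x)
    escape-avoids {x} ¬au Qx x⟶y with any? (λ y → (x ⟶? y) ×-dec ¬? (au? y))
    ... | yes (_ , _ , ¬au′) = ¬au′
    ... | no all-au = contradiction
      (step Qx (_ , x⟶y) λ {z} x⟶z → decidable-stable (au? z) (λ ¬auz → all-au (z , x⟶z , ¬auz)))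
      ¬au

    abstract
      -- If `x` fails `AU`, the maximal path following `escape` stays outside `AU` up to position
      -- `i`, because `Q` holds before `i`; yet `P` at `i` gives `AU` there. Decidability turns this
      -- refutation into a proof.
      until⇒AU : ∀ {x} → AllMaximalPathsFrom G x (Until Q P) → AU _⟶_ Q P x
      until⇒AU {x} all with au? x | maximal-walk escape escape-succ x
      ... | yes au | _ = au
      ... | no ¬au | π , follow , path , maximal , refl
        with all π path maximal refl
      ... | i , v , at , Pv , before = contradiction (here Pv) (avoids i ≤-refl at)
        where
        avoids : ∀ k {u} → k ≤ i → π [ k ]= u → ¬ AU _⟶_ Q P u
        avoids zero    _   at rewrite at-first π at = ¬au
        avoids (suc k) k<i at with walk-pred π follow at
        ... | t , atₖ , t⟶u , refl =
          escape-avoids (avoids k (<⇒≤ k<i) atₖ) (before k<i atₖ) t⟶u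

-- Until derivations, chains and cyclic lists.

module _ {A : Set} where

  module _ {_⟶_ : Rel A 0ℓ} {Q P : Pred A 0ℓ} where

    AU-bind : ∀ {P′} → P ⊆ AU _⟶_ Q P′ → AU _⟶_ Q P ⊆ AU _⟶_ Q P′
    AU-bind k (here Px)        = k Px
    AU-bind k (step Qx live f) = step Qx live (λ x⟶y → AU-bind k (f x⟶y))

    AU-succ : ∀ {x y} → AU _⟶_ Q P x → x ∉ P → x ⟶ y → AU _⟶_ Q P y
    AU-succ (here Px)    x∉P x⟶y = contradiction Px x∉P
    AU-succ (step _ _ f) x∉P x⟶y = f x⟶y

  -- Chain R x xs y: an R-path from x to y, where xs omits the final y.
  data Chain (R : Rel A 0ℓ) : A → List A → A → Set where
    []  : ∀ {x} → Chain R x [] x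
    _∷_ : ∀ {x y z xs} → R x y → Chain R y xs z → Chain R x (x ∷ xs) z

  module _ {R : Rel A 0ℓ} where

    chain-++ : ∀ {x y z xs ys} → Chain R x xs y → Chain R y ys z → Chain R x (xs ++ ys) z
    chain-++ []      d = d
    chain-++ (r ∷ c) d = r ∷ chain-++ c d

    chain-split : ∀ {x z} xs {ys} → Chain R x (xs ++ ys) z →
                  ∃ λ y → Chain R x xs y × Chain R y ys z
    chain-split []       c       = _ , [] , c
    chain-split (_ ∷ xs) (r ∷ c) = let y , d , e = chain-split xs c in y , r ∷ d , e

    chain-at : ∀ {x y z} xs {ys} → Chain R x (xs ++ y ∷ ys) z →
               Chain R x xs y × Chain R y (y ∷ ys) z
    chain-at xs c with chain-split xs c
    ... | _ , d , e@(_ ∷ _) = d , e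

    chain-next : ∀ {x z u xs} → Chain R x xs z → u ∈ˡ xs → ∃ λ v → R u v × (v ∈ˡ xs ⊎ v ≡ z)
    chain-next (r ∷ [])      (here refl) = _ , r , inj₂ refl
    chain-next (r ∷ (_ ∷ _)) (here refl) = _ , r , inj₁ (there (here refl))
    chain-next (r ∷ c)       (there u∈) with chain-next c u∈
    ... | v , s , inj₁ v∈   = v , s , inj₁ (there v∈)
    ... | v , s , inj₂ refl = v , s , inj₂ refl

    chain-linked : ∀ {x z xs} → Chain R x xs z → Linked R xs
    chain-linked []              = []
    chain-linked (r ∷ [])        = [-]
    chain-linked (r ∷ c@(_ ∷ _)) = r ∷ chain-linked c

    -- The target, which the list omits, is a successor that `next` supplies for the last node.
    linked-chain : ∀ {P : Pred A 0ℓ} → (∀ {v} → v ∈ P → ∃ (R v)) →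
                   ∀ {x xs} → Linked R (x ∷ xs) → All P (x ∷ xs) → ∃ (Chain R x (x ∷ xs))
    linked-chain next [-]     (Px ∷ _)  = let _ , r = next Px in _ , r ∷ []
    linked-chain next (r ∷ l) (_ ∷ Pxs) = let z , c = linked-chain next l Pxs in z , r ∷ c

  unique-rotate : ∀ (xs ys : List A) → Unique (xs ++ ys) → Unique (ys ++ xs)
  unique-rotate xs ys = Permutationₛ.Unique-resp-↭ (setoid A) (↭⇒↭ₛ (++-comm xs ys))

  unique-after : ∀ (xs : List A) {y ys} → Unique (xs ++ y ∷ ys) → All (y ≢_) ys
  unique-after xs {y} {ys} unique with unique-rotate xs (y ∷ ys) unique
  ... | y≢ ∷ _ = All.++⁻ˡ ys y≢

  -- The base point is existential, so that a rotation changes only the witness.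
  Cyclic : Rel A 0ℓ → Pred (List A) 0ℓ
  Cyclic R xs = (∃ λ v → Chain R v xs v) × Unique xs

  cyclic-rotate : ∀ {R} xs {ys} → Cyclic R (xs ++ ys) → Cyclic R (ys ++ xs)
  cyclic-rotate xs {ys} ((_ , c) , unique) =
    let _ , d , e = chain-split xs c in (_ , chain-++ e d) , unique-rotate xs ys unique

  module _ {P Q : Pred A 0ℓ} where

    last-split : Decidable Q → ∀ {xs} → All (P ∪ Q) xs → Any Q xs →
                 ∃ λ ys → ∃₂ λ v zs → xs ≡ ys ++ v ∷ zs × All (P ∪ Q) ys × v ∈ Q × All (P ∖ Q) zs
    last-split Q? {x ∷ xs} (PQx ∷ PQxs) Qxs with Any.any? Q? xs
    ... | yes Q-later with last-split Q? PQxs Q-later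
    ...   | ys , v , zs , refl , PQys , Qv , Pzs = x ∷ ys , v , zs , refl , PQx ∷ PQys , Qv , Pzs
    last-split Q? {x ∷ xs} (PQx ∷ PQxs) (there Qxs) | no ¬Q = contradiction Qxs ¬Q
    last-split Q? {x ∷ xs} (PQx ∷ PQxs) (here Qx)   | no ¬Q =
      [] , x , xs , refl , [] , Qx ,
      All.zipWith (λ { (inj₁ p , ¬q) → p , ¬q ; (inj₂ q , ¬q) → contradiction q ¬q })
                  (PQxs , All.¬Any⇒All¬ _ ¬Q)

  -- Regular languages over classes of letters.

  module _ {P : Pred A 0ℓ} where

    ⋆⇒All : ∀ {xs} → xs ∈ ⟦ P ⟧ ⋆ → All P xs
    ⋆⇒All (_ , letters , refl) = All.concat⁺ (All.map (λ { (_ , Pa , refl) → Pa ∷ [] }) letters)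

    All⇒⋆ : ∀ {xs} → All P xs → xs ∈ ⟦ P ⟧ ⋆
    All⇒⋆ []         = [] , [] , refl
    All⇒⋆ (Px ∷ Pxs) with All⇒⋆ Pxs
    ... | us , letters , refl = _ ∷ us , (_ , Px , refl) ∷ letters , refl

  module _ {P Q : Pred A 0ℓ} where

    -- With `All⇒blocks`, this is the regular identity between `P*(QP*)*` and `(P ∪ Q)*`.
    blocks⇒All : ∀ {xs ys} → xs ∈ ⟦ P ⟧ ⋆ → ys ∈ (⟦ Q ⟧ · ⟦ P ⟧ ⋆) ⋆ → All (P ∪ Q) (xs ++ ys)
    blocks⇒All Pxs (_ , blocks , refl) =
      All.++⁺ (All.map inj₁ (⋆⇒All Pxs)) (All.concat⁺ (All.map block blocks))
      where
      block : ∀ {ys} → ys ∈ ⟦ Q ⟧ · ⟦ P ⟧ ⋆ → All (P ∪ Q) ys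
      block (_ , _ , (_ , Qb , refl) , Pv , refl) = inj₂ Qb ∷ All.map inj₁ (⋆⇒All Pv)

    All⇒blocks : ∀ {xs} → All (P ∪ Q) xs →
                 ∃₂ λ us vs → us ∈ ⟦ P ⟧ ⋆ × vs ∈ (⟦ Q ⟧ · ⟦ P ⟧ ⋆) ⋆ × xs ≡ us ++ vs
    All⇒blocks [] = [] , [] , ([] , [] , refl) , ([] , [] , refl) , refl
    All⇒blocks (PQx ∷ PQxs) with PQx | All⇒blocks PQxs
    ... | inj₁ Px | us , vs , (_ , Pus , refl) , Qvs , refl =
      _ ∷ us , vs , (_ , (_ , Px , refl) ∷ Pus , refl) , Qvs , refl
    ... | inj₂ Qx | us , vs , Pus , (_ , Qvs , refl) , refl =
      [] , _ , ([] , [] , refl) , (_ , (_ , _ , (_ , Qx , refl) , Pus , refl) ∷ Qvs , refl) , refl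

  module _ (P Q₁ Q₂ : Pred A 0ℓ) where

    Separated : Language A
    Separated = ⟦ Q₁ ⟧ · ⟦ P ⟧ ⋆ · (⟦ Q₂ ⟧ · ⟦ P ⟧ ⋆) ⋆ · ⟦ Q₂ ⟧ · ⟦ P ⟧ ⋆ · (⟦ Q₁ ⟧ · ⟦ P ⟧ ⋆) ⋆

    -- By that identity the starred factors merge, leaving two marked letters, each followed by a
    -- free word over two classes.
    separated⁻ : ∀ {w} → w ∈ Separated →
                 ∃₂ λ a m → ∃₂ λ b t →
                 w ≡ a ∷ m ++ b ∷ t × a ∈ Q₁ × All (P ∪ Q₂) m × b ∈ Q₂ × All (P ∪ Q₁) t
    separated⁻ (_ , _ , (a , Qa , refl) , (m₁ , _ , Pm₁ , (m₂ , _ , Qm₂ ,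
                (_ , _ , (b , Qb , refl) , (t₁ , t₂ , Pt₁ , Qt₂ , refl) , refl) , refl) , refl) , refl) =
      a , m₁ ++ m₂ , b , t₁ ++ t₂ , cong (a ∷_) (sym (++-assoc m₁ m₂ _)) ,
      Qa , blocks⇒All Pm₁ Qm₂ , Qb , blocks⇒All Pt₁ Qt₂

    separated⁺ : ∀ {a b m t} → a ∈ Q₁ → All (P ∪ Q₂) m → b ∈ Q₂ → All (P ∪ Q₁) t →
                 a ∷ m ++ b ∷ t ∈ Separated
    separated⁺ {a} {b} Qa PQm Qb PQt with All⇒blocks PQm | All⇒blocks PQt
    ... | m₁ , m₂ , Pm₁ , Qm₂ , refl | t₁ , t₂ , Pt₁ , Qt₂ , refl =
      _ , _ , (a , Qa , refl) , (m₁ , _ , Pm₁ , (m₂ , _ , Qm₂ ,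
        (_ , _ , (b , Qb , refl) , (t₁ , t₂ , Pt₁ , Qt₂ , refl) , refl) , refl) ,
        ++-assoc m₁ m₂ _) , refl

-- The edges of `A_p` and first entries into `Vp`.

module _ (G : CFG) (p : Node G) where

  open CFG G using (_⟶_)

  private
    Vp : Pred (Node G) 0ℓ
    Vp = V[_] G p

    AF : Node G → Pred (Node G) 0ℓ
    AF w = AU _⟶_ Always (_≡ w)

  Vp⇒AF : ∀ {w} → w ∈ Vp → AF w p
  Vp⇒AF w∈Vp = until⇒AU G (λ _ → yes tt) (_≟ᶠ _)
    (λ π path maximal eq → occurs⇒until π (w∈Vp π path maximal eq))

  Vp? : Decidable Vp
  Vp? w = map′ (λ af π path maximal eq → until⇒occurs π (AU⇒until G af π path maximal eq)) Vp⇒AF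
               (AU? (_⟶?_ G) (λ _ → yes tt) (_≟ᶠ w) p)

  infix 4 _⇝_

  -- `FirstHit` recast as an instance of `EU`, which makes it decidable and open to induction along
  -- the path.
  _⇝_ : Rel (Node G) 0ℓ
  s ⇝ v = EU _⟶_ (_∉ Vp) (λ u → u ≡ v × u ∈ Vp) s

  ⇝-target : ∀ {s v} → s ⇝ v → v ∈ Vp
  ⇝-target (here (refl , v∈Vp)) = v∈Vp
  ⇝-target (step _ _ s⇝v)       = ⇝-target s⇝v

  firstHit⇒⇝ : ∀ {s v} → FirstHit G p s v → s ⇝ v
  firstHit⇒⇝ (v∈Vp , ms , path , refl , ms∉) = go ms path ms∉
    where
    go : ∀ ms → IsPath G (finite (ms ∷ʳ _)) → All (_∉ Vp) ms → head (ms ∷ʳ _) ⇝ _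
    go []           _            _           = here (refl , v∈Vp)
    go (_ ∷ [])     (s⟶v ∷ [-])  (s∉ ∷ _)    = step s∉ s⟶v (here (refl , v∈Vp))
    go (_ ∷ u ∷ ms) (s⟶u ∷ path) (s∉ ∷ rest) = step s∉ s⟶u (go (u ∷ ms) path rest)

  ⇝⇒firstHit : ∀ {s v} → s ⇝ v → FirstHit G p s v
  ⇝⇒firstHit (here (refl , v∈Vp)) = v∈Vp , [] , [-] , refl , []
  ⇝⇒firstHit (step {x = s} s∉ s⟶u u⇝v) with ⇝⇒firstHit u⇝v
  ... | v∈ , []     , path , refl , rest = v∈ , s ∷ []     , s⟶u ∷ [-]  , refl , s∉ ∷ rest
  ... | v∈ , m ∷ ms , path , refl , rest = v∈ , s ∷ m ∷ ms , s⟶u ∷ path , refl , s∉ ∷ rest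

  firstHit? : ∀ s → Decidable (FirstHit G p s)
  firstHit? s v = map′ ⇝⇒firstHit firstHit⇒⇝
    (EU? (_⟶?_ G) (¬? ∘ Vp?) (λ u → (u ≟ᶠ v) ×-dec Vp? u) s)

  -- The edges of A_p, each interval cut after its first step.
  data R (x y : Node G) : Set where
    edge : ∀ {t} → x ∈ Vp → x ⟶ t → t ⇝ y → R x y

  interval⇒R : ∀ {x y} → Interval G Vp x y → R x y
  interval⇒R (x∈Vp , y∈Vp , ms , path , ms∉) =
    let _ , x⟶t , t⇝y = go ms path ms∉ in edge x∈Vp x⟶t t⇝y
    where
    go : ∀ {x} ms → IsPath G (finite (x ∷ (ms ∷ʳˡ _))) → All (_∉ Vp) ms → ∃ λ t → x ⟶ t × t ⇝ _
    go []       (x⟶y ∷ [-])  _         = _ , x⟶y , here (refl , y∈Vp)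
    go (m ∷ ms) (x⟶m ∷ path) (m∉ ∷ ∉s) = let _ , m⟶t , t⇝y = go ms path ∉s in
      m , x⟶m , step m∉ m⟶t t⇝y

  R⇒interval : ∀ {x y} → R x y → Interval G Vp x y
  R⇒interval (edge x∈Vp x⟶t t⇝y) =
    let ms , path , ms∉ = go x⟶t t⇝y in x∈Vp , ⇝-target t⇝y , ms , path , ms∉
    where
    go : ∀ {x t y} → x ⟶ t → t ⇝ y →
         ∃ λ ms → IsPath G (finite (x ∷ (ms ∷ʳˡ y))) × All (_∉ Vp) ms
    go x⟶y (here (refl , _))   = [] , x⟶y ∷ [-] , []
    go x⟶t (step t∉ t⟶u u⇝y) = let ms , path , ms∉ = go t⟶u u⇝y in
      _ ∷ ms , x⟶t ∷ path , t∉ ∷ ms∉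

  R-source : ∀ {x y} → R x y → x ∈ Vp
  R-source (edge x∈Vp _ _) = x∈Vp

  R-target : ∀ {x y} → R x y → y ∈ Vp
  R-target (edge _ _ t⇝y) = ⇝-target t⇝y

  -- The nodes passed before `v` lie outside `Vp`, hence outside `P`, so the derivation cannot stop
  -- before `v`.
  AU-⇝ : ∀ {Q P s v} → P ⊆ Vp → s ⇝ v → AU _⟶_ Q P s → AU _⟶_ Q P v
  AU-⇝ P⊆Vp (here (refl , _))   au = au
  AU-⇝ P⊆Vp (step s∉ s⟶t t⇝v) au = AU-⇝ P⊆Vp t⇝v (AU-succ au (s∉ ∘ P⊆Vp) s⟶t)

  AU-R : ∀ {Q P x y} → P ⊆ Vp → R x y → x ∉ P → AU _⟶_ Q P x → AU _⟶_ Q P y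
  AU-R P⊆Vp (edge _ x⟶t t⇝y) x∉P au = AU-⇝ P⊆Vp t⇝y (AU-succ au x∉P x⟶t)

  AF-R : ∀ {w x y} → w ∈ Vp → R x y → x ≢ w → AF w x → AF w y
  AF-R w∈Vp = AU-R (λ { refl → w∈Vp })

  -- Staying forever inside an A_p-closed set L yields a maximal path that meets V_p only in L.
  closed-hit : ∀ {L : Pred (Node G) 0ℓ} {w v} → (∀ {u} → L u → ∃ λ u′ → R u u′ × L u′) →
               w ∈ Vp → L v → v ∈ Vp → AF w v → L w
  closed-hit {L} {w} closed w∈Vp Lv v∈Vp af = go af (here (refl , v∈Vp)) Lv
    where
    -- Recursion on the `AF` derivation; `t ⇝ v` is the rest of the way to the next node `v` of `L`.
    go : ∀ {t v} → AF w t → t ⇝ v → L v → L w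
    go (here refl)   (here (refl , _))   Lv = Lv
    go (here refl)   (step w∉ _ _)      Lv = contradiction w∈Vp w∉
    go (step _ _ f)  (step _ t⟶u u⇝v)   Lv = go (f t⟶u) u⇝v Lv
    go (step _ _ f)  (here (refl , _))   Lv with closed Lv
    ... | _ , edge _ t⟶u u⇝v′ , Lv′ = go (f t⟶u) u⇝v′ Lv′

  -- If some u ≠ x, y with A_p-edges to x and y were reachable from x, then one could return to u
  -- avoiding x or avoiding y, and alternating this with the edge to the other node
  -- would miss x or y for ever.
  fork : ∀ {u x y} → R u x → R u y → x ≢ y → x ≢ u → y ≢ u → AF x u → AF y u → ¬ Star R x u
  fork {u} {x} {y} Rux Ruy x≢y x≢u y≢u afx afy path = start (avoid path)
    where
    R′ : Rel (Node G) 0ℓ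
    R′ s t = s ≢ x × s ≢ y × R s t

    start : ¬ Star R′ x u
    start ε                   = x≢u refl
    start ((x≢x , _ , _) ◅ _) = x≢x refl

    trap : ∀ {v w t} → R u v → w ∈ Vp → v ≢ w → w ≢ u → (∀ {s} → Star R′ s u → s ≢ w) →
           AF w u → R v t → Star R′ t u → ⊥
    trap {v} {w} {t} Ruv w∈Vp v≢w w≢u avoids af Rvt path =
      [ v≢w ∘ sym , (λ w→u → avoids w→u refl) ]′
        (closed-hit {L = L} closed w∈Vp (inj₁ refl) (R-source Rvt) (AF-R w∈Vp Ruv (w≢u ∘ sym) af))
      where
      -- The loop from `u` through `v` and `t` back to `u` stays in `L`, while `w` is neither `v`
      -- nor on such a return path.
      L : Pred (Node G) 0ℓ
      L s = s ≡ v ⊎ Star R′ s u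

      closed : ∀ {s} → L s → ∃ λ s′ → R s s′ × L s′
      closed (inj₁ refl)              = t , Rvt , inj₂ path
      closed (inj₂ ε)                 = v , Ruv , inj₁ refl
      closed (inj₂ ((_ , _ , r) ◅ s)) = _ , r , inj₂ s

    x-avoided : ∀ {s} → Star R′ s u → s ≢ x
    x-avoided ε                   = x≢u ∘ sym
    x-avoided ((s≢x , _ , _) ◅ _) = s≢x

    y-avoided : ∀ {s} → Star R′ s u → s ≢ y
    y-avoided ε                   = y≢u ∘ sym
    y-avoided ((_ , s≢y , _) ◅ _) = s≢y

    avoid : ∀ {s} → Star R s u → Star R′ s u
    avoid ε = ε
    avoid {s} (r ◅ path) with s ≟ᶠ x | s ≟ᶠ y
    -- The rest of the path already avoids both nodes; closed up by the edge from `u` to `x`, it is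
    -- a loop that misses `y`. The next case is symmetric.
    ... | yes refl | _        = ⊥-elim (trap Rux (R-target Ruy) x≢y y≢u y-avoided afy r (avoid path))
    ... | no _     | yes refl = ⊥-elim (trap Ruy (R-target Rux) (x≢y ∘ sym) x≢u x-avoided afx r (avoid path))
    ... | no s≢x   | no s≢y   = (s≢x , s≢y , r) ◅ avoid path

  -- The nodes of `A_p` other than `p` form a single cycle.

  module Cycle {x y} (x≢y : x ≢ y) (Rpx : R p x) (Rpy : R p y) where

    -- The nodes of C.
    K : Pred (Node G) 0ℓ
    K = Vp ∖ (p ≡_)

    x∈Vp : x ∈ Vp
    x∈Vp = R-target Rpx

    y∈Vp : y ∈ Vp
    y∈Vp = R-target Rpy

    p∈Vp : p ∈ Vp
    p∈Vp = R-source Rpx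

    -- A loop would make the singleton of `p` closed, forcing both `x` and `y` to equal `p`.
    ¬Rpp : ¬ R p p
    ¬Rpp Rpp = x≢y (trans (only x∈Vp) (sym (only y∈Vp)))
      where
      only : ∀ {w} → w ∈ Vp → w ≡ p
      only w∈Vp = closed-hit {L = _≡ p} (λ { refl → p , Rpp , refl }) w∈Vp refl p∈Vp (Vp⇒AF w∈Vp)

    x∈K : x ∈ K
    x∈K = x∈Vp , λ { refl → ¬Rpp Rpx }

    y∈K : y ∈ K
    y∈K = y∈Vp , λ { refl → ¬Rpp Rpy }

    -- Every path from p visits x and y alternately for ever, so AF x holds from then on.
    Recurrent : Pred (Node G) 0ℓ
    Recurrent = AF x

    recurrent-p : Recurrent p
    recurrent-p = Vp⇒AF x∈Vp

    AF-from-x : ∀ {w} → w ∈ K → AF w x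
    AF-from-x (w∈Vp , p≢w) = AF-R w∈Vp Rpx p≢w (Vp⇒AF w∈Vp)

    AF-x-from-y : AF x y
    AF-x-from-y = AF-R x∈Vp Rpy (proj₂ x∈K) (Vp⇒AF x∈Vp)

    recurrent-AF : ∀ {w t} → w ∈ K → Recurrent t → AF w t
    recurrent-AF w∈K = AU-bind λ { refl → AF-from-x w∈K }

    -- The promise of `x` is used up only at `x` itself; from there `y` is inevitable, and from `y`
    -- again `x`.
    recurrent-succ : ∀ {t u} → Recurrent t → t ⟶ u → Recurrent u
    recurrent-succ {t} rt t⟶u with t ≟ᶠ x
    ... | no t≢x   = AU-succ rt t≢x t⟶u
    ... | yes refl = AU-bind (λ { refl → AF-x-from-y }) (AU-succ (AF-from-x y∈K) x≢y t⟶u)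

    recurrent-live : ∀ {t} → Recurrent t → ∃ (t ⟶_)
    recurrent-live (step _ live _) = live
    recurrent-live (here refl) with AF-from-x y∈K
    ... | step _ live _ = live
    ... | here x≡y      = contradiction x≡y x≢y

    -- Any choice of successors leads to `w`; the nodes of `Vp` met on the way form the path in
    -- `A_p`.
    reach : ∀ {w t} → w ∈ Vp → AF w t → Recurrent t → ∃ λ v → t ⇝ v × Star R v w
    reach w∈Vp (here refl) rt = _ , here (refl , w∈Vp) , ε
    reach {t = t} w∈Vp (step _ (_ , t⟶u) f) rt
      with reach w∈Vp (f t⟶u) (recurrent-succ rt t⟶u) | Vp? t
    ... | v , u⇝v , path | yes t∈Vp = t , here (refl , t∈Vp) , edge t∈Vp t⟶u u⇝v ◅ path
    ... | v , u⇝v , path | no t∉Vp  = v , step t∉Vp t⟶u u⇝v , path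

    reach-Vp : ∀ {v w} → v ∈ Vp → w ∈ Vp → AF w v → Recurrent v → Star R v w
    reach-Vp v∈Vp w∈Vp af rv with reach w∈Vp af rv
    ... | _ , here (refl , _) , path = path
    ... | _ , step v∉ _ _     , _    = contradiction v∈Vp v∉

    recurrent-⇝ : ∀ {t v} → t ⇝ v → Recurrent t → Recurrent v
    recurrent-⇝ (here (refl , _))  rt = rt
    recurrent-⇝ (step _ t⟶u u⇝v) rt = recurrent-⇝ u⇝v (recurrent-succ rt t⟶u)

    -- Every such `v` is reachable from `p` in `A_p`, and recurrence passes along edges.
    recurrent-Vp : ∀ {v} → v ∈ Vp → Recurrent v
    recurrent-Vp v∈Vp = go (reach-Vp p∈Vp v∈Vp (Vp⇒AF v∈Vp) recurrent-p) recurrent-p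
      where
      go : ∀ {u v} → Star R u v → Recurrent u → Recurrent v
      go ε          ru = ru
      go (edge _ u⟶t t⇝v ◅ path) ru = go path (recurrent-⇝ t⇝v (recurrent-succ ru u⟶t))

    R-next : ∀ {v} → v ∈ Vp → ∃ (R v)
    R-next v∈Vp =
      let rv        = recurrent-Vp v∈Vp
          t , v⟶t   = recurrent-live rv
          rt        = recurrent-succ rv v⟶t
          u , t⇝u , _ = reach x∈Vp rt rt
      in u , edge v∈Vp v⟶t t⇝u

    connected : ∀ {v w} → v ∈ Vp → w ∈ K → Star R v w
    connected v∈Vp w∈K =
      reach-Vp v∈Vp (proj₁ w∈K) (recurrent-AF w∈K (recurrent-Vp v∈Vp)) (recurrent-Vp v∈Vp)

    -- A return to `p` would complete a path from `x` to `p`, which `fork` at `p` forbids.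
    no-return : ∀ {v} → ¬ R v p
    no-return {v} Rvp with p ≟ᶠ v
    ... | yes refl = ¬Rpp Rvp
    ... | no p≢v   = fork Rpx Rpy x≢y (proj₂ x∈K ∘ sym) (proj₂ y∈K ∘ sym)
      (Vp⇒AF x∈Vp) (Vp⇒AF y∈Vp) (connected x∈Vp (R-source Rvp , p≢v) ◅◅ Rvp ◅ ε)

    R-target-K : ∀ {v w} → R v w → w ∈ K
    R-target-K Rvw = R-target Rvw , λ { refl → no-return Rvw }

    R-irrefl : ∀ {v} → ¬ R v v
    R-irrefl {v} Rvv = x≢y (trans (only x∈K) (sym (only y∈K)))
      where
      only : ∀ {w} → w ∈ K → w ≡ v
      only w∈K = closed-hit {L = _≡ v} (λ { refl → v , Rvv , refl }) (proj₁ w∈K) refl (R-source Rvv)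
        (recurrent-AF w∈K (recurrent-Vp (R-source Rvv)))

    -- Two distinct successors of `v` would be a fork, but `connected` leads from either back to
    -- `v`.
    functional : ∀ {v u w} → v ∈ K → R v u → R v w → u ≡ w
    functional {v} {u} {w} v∈K Rvu Rvw with u ≟ᶠ w
    ... | yes u≡w = u≡w
    ... | no u≢w  = contradiction (connected (R-target Rvu) v∈K)
      (fork Rvu Rvw u≢w (λ { refl → R-irrefl Rvu }) (λ { refl → R-irrefl Rvw })
        (af (R-target-K Rvu)) (af (R-target-K Rvw)))
      where
      af : ∀ {w} → w ∈ K → AF w v
      af w∈K = recurrent-AF w∈K (recurrent-Vp (proj₁ v∈K))

    first-return : ∀ {v w} → Star R v w → ∃ λ xs → Chain R v xs w × w ∉ˡ xs
    first-return ε = [] , [] , λ ()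
    first-return {v} {w} (r ◅ path) with v ≟ᶠ w | first-return path
    ... | yes refl | _ = [] , [] , λ ()
    ... | no v≢w   | xs , chain , w∉xs = v ∷ xs , r ∷ chain ,
      λ { (here refl) → v≢w refl ; (there w∈xs) → w∉xs w∈xs }

    -- The nodes of a closed chain form a closed set, so `closed-hit` finds all of `K` among them.
    closed-complete : ∀ {v xs w} → Chain R v (v ∷ xs) v → w ∈ K → w ∈ˡ v ∷ xs
    closed-complete {v} {xs} cyc@(r ∷ _) w∈K =
      closed-hit {L = _∈ˡ v ∷ xs} closed (proj₁ w∈K) (here refl) (R-source r)
        (recurrent-AF w∈K (recurrent-Vp (R-source r)))
      where
      closed : ∀ {u} → u ∈ˡ v ∷ xs → ∃ λ u′ → R u u′ × u′ ∈ˡ v ∷ xs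
      closed u∈ with chain-next cyc u∈
      ... | u′ , Ruu′ , inj₁ u′∈   = u′ , Ruu′ , u′∈
      ... | u′ , Ruu′ , inj₂ refl = u′ , Ruu′ , here refl

    -- A repeated node would cut out a closed chain without `v`, contrary to `closed-complete`.
    chain-unique : ∀ {t xs v} → v ∈ K → Chain R t xs v → v ∉ˡ xs → Unique xs
    chain-unique v∈K []      v∉ = []
    chain-unique v∈K (_∷_ {x = t} {xs = xs} r c) v∉ =
      All.tabulate t≢ ∷ chain-unique v∈K c (v∉ ∘ there)
      where
      t≢ : ∀ {u} → u ∈ˡ xs → t ≢ u
      t≢ t∈ refl =
        let ys , _ , eq = ∈-∃++ t∈
            d , _ = chain-at ys (subst (λ zs → Chain R _ zs _) eq c)
        in v∉ (there-++ eq (closed-complete (r ∷ d) v∈K))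
        where
        there-++ : ∀ {w ys zs} → xs ≡ ys ++ zs → w ∈ˡ t ∷ ys → w ∈ˡ t ∷ xs
        there-++ refl (here refl) = here refl
        there-++ refl (there w∈)  = there (∈-++⁺ˡ w∈)

    chain-K : ∀ {v xs w} → v ∈ K → Chain R v xs w → All K xs
    chain-K v∈K []      = []
    chain-K v∈K (r ∷ c) = v∈K ∷ chain-K (R-target-K r) c

    cycle-from : ∀ {v} → v ∈ K → ∃ λ xs → Cyclic R (v ∷ xs)
    cycle-from {v} v∈K with R-next (proj₁ v∈K)
    ... | _ , r with first-return (connected (R-target r) v∈K)
    ...   | xs , c , v∉xs =
      xs , (v , r ∷ c) , All.¬Any⇒All¬ xs v∉xs ∷ chain-unique v∈K c v∉xs

    cyclic-unfolding : ∀ {v xs} → v ∈ K → Cyclic R (v ∷ xs) → Unfolding (C[_] G p) (v ∷ xs)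
    cyclic-unfolding v∈K ((_ , cyc@(_ ∷ _)) , unique) =
      All.map (λ (v∈Vp , p≢v) → v∈Vp , v∈Vp , p≢v) all-K ,
      linked all-K (chain-linked cyc) , unique , λ w (_ , w∈K) → closed-complete cyc w∈K
      where
      all-K = chain-K v∈K cyc

      linked : ∀ {xs} → All K xs → Linked R xs → Linked (edges (C[_] G p)) xs
      linked _                []      = []
      linked _                [-]     = [-]
      linked (u∈K ∷ w∈K ∷ Ks) (r ∷ l) = (u∈K , w∈K , R⇒interval r) ∷ linked (w∈K ∷ Ks) l

    -- The successor `z` of the last node occurs in the unfolding. If it occurred after `v`, the
    -- closed chain through `z` would miss `v`.
    unfolding-cycle : ∀ {v xs} → Unfolding (C[_] G p) (v ∷ xs) → Chain R v (v ∷ xs) v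
    unfolding-cycle {v} {xs} (nodes , linked , v∉xs ∷ _ , complete)
      with linked-chain (R-next ∘ proj₁) (Linked.map (λ (_ , _ , i) → interval⇒R i) linked) (All.map proj₂ nodes)
    ... | z , chain@(_ ∷ c) = close (complete z (proj₁ z∈K , z∈K))
      where
      chain-target : ∀ {u w u′ ys} → Chain R u (u′ ∷ ys) w → w ∈ K
      chain-target (r ∷ [])        = R-target-K r
      chain-target (r ∷ c@(_ ∷ _)) = chain-target c

      z∈K = chain-target chain

      close : z ∈ˡ v ∷ xs → Chain R v (v ∷ xs) v
      close (here refl) = chain
      close (there z∈xs) with ∈-∃++ z∈xs
      ... | ys , _ , refl = contradiction
        (∈-++⁺ʳ ys (closed-complete (proj₂ (chain-at ys c)) (proj₂ (All.head nodes))))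
        (All.All¬⇒¬Any v∉xs)

    -- Recurrence guarantees that every path enters `Vp`, so it is enough to continue from each
    -- possible first entry.
    AU-enter : ∀ {Q P t} → (∀ {u} → u ∉ Vp → Q u) → Recurrent t →
               (∀ {v} → t ⇝ v → AU _⟶_ Q P v) → AU _⟶_ Q P t
    AU-enter {t = t} Q⊇ rt au with Vp? t
    ... | yes t∈Vp = au (here (refl , t∈Vp))
    AU-enter Q⊇ (here refl) au | no t∉Vp = contradiction x∈Vp t∉Vp
    AU-enter Q⊇ (step _ live f) au | no t∉Vp =
      step (Q⊇ t∉Vp) live (λ t⟶u → AU-enter Q⊇ (f t⟶u) (au ∘ step t∉Vp t⟶u))

    -- By `functional`, every path in the graph must enter the nodes of the chain in order.
    AU-chain : ∀ {Q P v xs w} → (∀ {u} → u ∉ Vp → Q u) → v ∈ K → Chain R v xs w → All Q xs →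
               AU _⟶_ Q P w → AU _⟶_ Q P v
    AU-chain Q⊇ v∈K []      _         au = au
    AU-chain {Q} {P} Q⊇ v∈K (r ∷ c) (Qv ∷ Qxs) au =
      step Qv (recurrent-live rv) λ v⟶t → AU-enter Q⊇ (recurrent-succ rv v⟶t) λ t⇝u →
        subst (AU _⟶_ Q P) (functional v∈K r (edge (proj₁ v∈K) v⟶t t⇝u))
              (AU-chain Q⊇ (R-target-K r) c Qxs au)
      where rv = recurrent-Vp (proj₁ v∈K)

    -- DOD pairs and separated unfoldings.

    module Branches {s₁ s₂} (p⟶s₁ : p ⟶ s₁) (p⟶s₂ : p ⟶ s₂)
                    (disjoint : Empty (FirstHit G p s₁ ∩ FirstHit G p s₂)) where

      private
        V₁ V₂ V₀ : Pred (Node G) 0ℓ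
        V₁ = FirstHit G p s₁
        V₂ = FirstHit G p s₂
        V₀ = Vp ∖ (V₁ ∪ V₂)

      recurrent-branch : ∀ {s} → p ⟶ s → Recurrent s
      recurrent-branch = recurrent-succ recurrent-p

      firstHit-K : ∀ {s} → p ⟶ s → FirstHit G p s ⊆ K
      firstHit-K p⟶s hit = R-target-K (edge p∈Vp p⟶s (firstHit⇒⇝ hit))

      firstHit-exists : ∀ {s} → p ⟶ s → ∃ (FirstHit G p s)
      firstHit-exists p⟶s =
        let rs = recurrent-branch p⟶s ; v , s⇝v , _ = reach x∈Vp rs rs in v , ⇝⇒firstHit s⇝v

      -- A first hit on the arc after a up to b would let a path from s reach b without meeting a.
      arc-avoids : ∀ {s a b xs} → a ∈ K → a ≢ b → a ∉ˡ xs → Chain R a (a ∷ xs) b →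
                   AU _⟶_ (_≢ b) (_≡ a) s → All (_∉ FirstHit G p s) (xs ++ [ b ])
      arc-avoids {s} {a} {b} {xs} a∈K a≢b a∉xs (_ ∷ c) au = All.tabulate avoids
        where
        ¬AU-b : ¬ AU _⟶_ (_≢ b) (_≡ a) b
        ¬AU-b (here b≡a)     = a≢b (sym b≡a)
        ¬AU-b (step b≢b _ _) = b≢b refl

        ¬AU-chain : ∀ {v ys} → Chain R v ys b → a ∉ˡ ys → ¬ AU _⟶_ (_≢ b) (_≡ a) v
        ¬AU-chain []      _    = ¬AU-b
        ¬AU-chain (r ∷ d) a∉ys au = ¬AU-chain d (a∉ys ∘ there)
          (AU-R (λ { refl → proj₁ a∈K }) r (λ { refl → a∉ys (here refl) }) au)

        avoids : ∀ {v} → v ∈ˡ xs ++ [ b ] → v ∉ FirstHit G p s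
        avoids v∈ hit with AU-⇝ (λ { refl → proj₁ a∈K }) (firstHit⇒⇝ hit) au | ∈-++⁻ xs v∈
        ... | au-v | inj₂ (here refl) = ¬AU-b au-v
        ... | au-v | inj₁ v∈xs with ∈-∃++ v∈xs
        ...   | ys , _ , refl = ¬AU-chain (proj₂ (chain-at ys c)) (a∉xs ∘ ∈-++⁺ʳ ys) au-v

      V₀∪V₂ : ∀ {xs} → All K xs → All (_∉ V₁) xs → All (V₀ ∪ V₂) xs
      V₀∪V₂ Ks ∉V₁ = All.zipWith classify (Ks , ∉V₁)
        where
        classify : ∀ {v} → v ∈ K × v ∉ V₁ → v ∈ V₀ ∪ V₂
        classify {v} ((v∈Vp , _) , v∉V₁) with firstHit? s₂ v
        ... | yes v∈V₂ = inj₂ v∈V₂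
        ... | no v∉V₂  = inj₁ (v∈Vp , [ v∉V₁ , v∉V₂ ]′)

      V₀∪V₁ : ∀ {xs} → All K xs → All (_∉ V₂) xs → All (V₀ ∪ V₁) xs
      V₀∪V₁ Ks ∉V₂ = All.zipWith classify (Ks , ∉V₂)
        where
        classify : ∀ {v} → v ∈ K × v ∉ V₂ → v ∈ V₀ ∪ V₁
        classify {v} ((v∈Vp , _) , v∉V₂) with firstHit? s₁ v
        ... | yes v∈V₁ = inj₂ v∈V₁
        ... | no v∉V₁  = inj₁ (v∈Vp , [ v∉V₁ , v∉V₂ ]′)

      DOD⇒separated : ∀ {a b} → DOD G p s₁ s₂ a b →
                      ∃ λ w → Unfolding (C[_] G p) w × toList w ∈ Separated V₀ V₁ V₂
      DOD⇒separated {a} {b} dod = cut (proj₂ (cycle-from a∈K))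
        where
        open DOD dod

        a∈K : a ∈ K
        a∈K = (λ π path maximal eq → proj₁ (both π path maximal eq)) , p≢a

        b∈K : b ∈ K
        b∈K = (λ π path maximal eq → proj₂ (both π path maximal eq)) , p≢b

        AU-a : AU _⟶_ (_≢ b) (_≡ a) s₁
        AU-a = until⇒AU G (λ v → ¬? (v ≟ᶠ b)) (_≟ᶠ a)
          (λ π path maximal eq → before⇒until π (a-first π path maximal eq))

        AU-b : AU _⟶_ (_≢ a) (_≡ b) s₂
        AU-b = until⇒AU G (λ v → ¬? (v ≟ᶠ a)) (_≟ᶠ b)
          (λ π path maximal eq → before⇒until π (b-first π path maximal eq))

        Goal : Set
        Goal = ∃ λ w → Unfolding (C[_] G p) w × toList w ∈ Separated V₀ V₁ V₂

        -- Here `xs` is the arc after `a` up to `b` and `ys` the arc after `b` up to `a`. The word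
        -- starts at the last `V₁`-node of `ys`; its marked `V₂`-letter is the last one in `xs`.
        assemble : ∀ {xs ys} → Cyclic R (xs ++ ys) →
                   All (V₀ ∪ V₂) xs → Any V₂ xs → All (V₀ ∪ V₁) ys → Any V₁ ys → Goal
        assemble cyc xs-V₂ ∃V₂ ys-V₁ ∃V₁
          with last-split (firstHit? s₂) xs-V₂ ∃V₂ | last-split (firstHit? s₁) ys-V₁ ∃V₁
        ... | m , v₂ , us , refl , m-V₂ , v₂∈V₂ , us-V₀
            | l , v₁ , us′ , refl , l-V₁ , v₁∈V₁ , us′-V₀ =
          v₁ ∷ (us′ ++ m) ++ v₂ ∷ us ++ l ,
          cyclic-unfolding (firstHit-K p⟶s₁ v₁∈V₁) (subst (Cyclic R) rearrange
            (cyclic-rotate (xs ++ l) (subst (Cyclic R) (sym (++-assoc xs l (v₁ ∷ us′))) cyc))) ,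
          separated⁺ V₀ V₁ V₂ v₁∈V₁
            (All.++⁺ (All.map (inj₁ ∘ proj₁) us′-V₀) m-V₂) v₂∈V₂
            (All.++⁺ (All.map (inj₁ ∘ proj₁) us-V₀) l-V₁)
          where
          xs = m ++ v₂ ∷ us

          rearrange : v₁ ∷ us′ ++ xs ++ l ≡ v₁ ∷ (us′ ++ m) ++ v₂ ∷ us ++ l
          rearrange = cong (v₁ ∷_) (trans (cong (us′ ++_) (++-assoc m (v₂ ∷ us) l))
                                          (sym (++-assoc us′ m (v₂ ∷ us ++ l))))

        cut : ∀ {ms} → Cyclic R (a ∷ ms) → Goal
        cut ((_ , cyc@(_ ∷ _)) , a≢ms ∷ unique) with closed-complete cyc b∈K
        ... | here refl = contradiction refl a≢b
        ... | there b∈ms with ∈-∃++ b∈ms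
        ...   | xs , ys , refl =
          assemble cyclic (V₀∪V₂ xs-K xs∉V₁) ∃V₂ (V₀∪V₁ ys-K ys∉V₂) ∃V₁
          where
          arcs = chain-at (a ∷ xs) cyc

          xs∉V₁ : All (_∉ V₁) (xs ++ [ b ])
          xs∉V₁ = arc-avoids a∈K a≢b (All.All¬⇒¬Any (All.++⁻ˡ xs a≢ms)) (proj₁ arcs) AU-a

          ys∉V₂ : All (_∉ V₂) (ys ++ [ a ])
          ys∉V₂ = arc-avoids b∈K (a≢b ∘ sym) (All.All¬⇒¬Any (unique-after xs unique)) (proj₂ arcs) AU-b

          xs-K : All K (xs ++ [ b ])
          xs-K = All.++⁺ (All.tail (chain-K a∈K (proj₁ arcs))) (b∈K ∷ [])

          ys-K : All K (ys ++ [ a ])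
          ys-K = All.++⁺ (All.tail (chain-K b∈K (proj₂ arcs))) (a∈K ∷ [])

          cyclic : Cyclic R ((xs ++ [ b ]) ++ ys ++ [ a ])
          -- Moving `a` to the end makes each arc contain its final endpoint only.
          cyclic = subst (Cyclic R)
            (trans (++-assoc xs (b ∷ ys) [ a ]) (sym (++-assoc xs [ b ] (ys ++ [ a ]))))
            (cyclic-rotate [ a ] ((_ , cyc) , a≢ms ∷ unique))

          locate : ∀ {v} → v ∈ K → v ∈ˡ xs ++ [ b ] ⊎ v ∈ˡ ys ++ [ a ]
          locate v∈K with closed-complete cyc v∈K
          ... | here refl = inj₂ (∈-++⁺ʳ ys (here refl))
          ... | there v∈ with ∈-++⁻ xs v∈
          ...   | inj₁ v∈xs         = inj₁ (∈-++⁺ˡ v∈xs)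
          ...   | inj₂ (here refl)  = inj₁ (∈-++⁺ʳ xs (here refl))
          ...   | inj₂ (there v∈ys) = inj₂ (∈-++⁺ˡ v∈ys)

          ∃V₂ : Any V₂ (xs ++ [ b ])
          -- Some first hit from `s₂` exists and lies on the cycle, and the other arc contains none.
          ∃V₂ = let v , v∈V₂ = firstHit-exists p⟶s₂ in
            [ (λ v∈ → lose v∈ v∈V₂)
            , (λ v∈ → contradiction v∈V₂ (All.lookup ys∉V₂ v∈))
            ]′ (locate (firstHit-K p⟶s₂ v∈V₂))

          ∃V₁ : Any V₁ (ys ++ [ a ])
          ∃V₁ = let v , v∈V₁ = firstHit-exists p⟶s₁ in
            [ (λ v∈ → contradiction v∈V₁ (All.lookup xs∉V₁ v∈))
            , (λ v∈ → lose v∈ v∈V₁)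
            ]′ (locate (firstHit-K p⟶s₁ v∈V₁))

      arc-AU : ∀ {Q u v w xs} → (∀ {t} → t ∉ Vp → Q t) → Chain R u xs w → v ∈ˡ xs → v ∈ K →
               All Q xs → AU _⟶_ Q (_≡ w) v
      arc-AU Q⊇ c v∈xs v∈K Qxs with ∈-∃++ v∈xs
      ... | ys , _ , refl = AU-chain Q⊇ v∈K (proj₂ (chain-at ys c)) (All.++⁻ʳ ys Qxs) (here refl)

      -- By disjointness `V₁` lies within `a` and `t`, and `V₂` within `m` and `b`. Going round the
      -- cycle, a node of `V₁` therefore meets `a` before `b`, and a node of `V₂` meets `b` before
      -- `a`.
      separated⇒DOD : PredicateNode G p s₁ s₂ →
                      (∃ λ w → Unfolding (C[_] G p) w × toList w ∈ Separated V₀ V₁ V₂) →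
                      ∃₂ λ a b → DOD G p s₁ s₂ a b
      separated⇒DOD branches (_ ∷ _ , unfolds@(_ , _ , unique , _) , w∈)
        with separated⁻ V₀ V₁ V₂ w∈
      ... | a , m , b , t , refl , a∈V₁ , m-V₂ , b∈V₂ , t-V₁ = a , b , record
        { p≢a     = proj₂ a∈K
        ; p≢b     = proj₂ b∈K
        ; a≢b     = a≢b
        ; branch  = branches
        ; both    = λ π path maximal eq → proj₁ a∈K π path maximal eq , proj₁ b∈K π path maximal eq
        ; a-first = λ π path maximal eq → until⇒before π a≢b (AU⇒until G AU-a π path maximal eq)
        ; b-first = λ π path maximal eq →
            until⇒before π (a≢b ∘ sym) (AU⇒until G AU-b π path maximal eq)
        }
        where
        a∈K = firstHit-K p⟶s₁ a∈V₁
        b∈K = firstHit-K p⟶s₂ b∈V₂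

        a≢b : a ≢ b
        a≢b refl = disjoint a (a∈V₁ , b∈V₂)

        cyc  = unfolding-cycle unfolds
        arcs = chain-at (a ∷ m) cyc

        m∉V₁ : ∀ {v} → v ∈ˡ m → v ∉ V₁
        m∉V₁ v∈m v∈V₁ with All.lookup m-V₂ v∈m
        ... | inj₁ (_ , v∉) = v∉ (inj₁ v∈V₁)
        ... | inj₂ v∈V₂     = disjoint _ (v∈V₁ , v∈V₂)

        t∉V₂ : ∀ {v} → v ∈ˡ t → v ∉ V₂
        t∉V₂ v∈t v∈V₂ with All.lookup t-V₁ v∈t
        ... | inj₁ (_ , v∉) = v∉ (inj₂ v∈V₂)
        ... | inj₂ v∈V₁     = disjoint _ (v∈V₁ , v∈V₂)

        position : ∀ {v} → v ∈ K → v ≡ a ⊎ v ∈ˡ m ⊎ v ≡ b ⊎ v ∈ˡ t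
        position v∈K with closed-complete cyc v∈K
        ... | here v≡a = inj₁ v≡a
        ... | there v∈ with ∈-++⁻ m v∈
        ...   | inj₁ v∈m         = inj₂ (inj₁ v∈m)
        ...   | inj₂ (here v≡b)  = inj₂ (inj₂ (inj₁ v≡b))
        ...   | inj₂ (there v∈t) = inj₂ (inj₂ (inj₂ v∈t))

        chain-tail : ∀ {u v w xs} → Chain R u (v ∷ xs) w → ∃ λ u′ → Chain R u′ xs w
        chain-tail (_ ∷ c) = _ , c

        a≢rest : All (a ≢_) (m ++ b ∷ t)
        a≢rest = AllPairs.head unique

        AU-a : AU _⟶_ (_≢ b) (_≡ a) s₁
        AU-a = AU-enter b∉ (recurrent-branch p⟶s₁) (from ∘ ⇝⇒firstHit)
          where
          b∉ : ∀ {u} → u ∉ Vp → u ≢ b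
          b∉ u∉Vp refl = u∉Vp (proj₁ b∈K)

          from : ∀ {v} → v ∈ V₁ → AU _⟶_ (_≢ b) (_≡ a) v
          from v∈V₁ with position (firstHit-K p⟶s₁ v∈V₁)
          ... | inj₁ v≡a                = here v≡a
          ... | inj₂ (inj₁ v∈m)         = contradiction v∈V₁ (m∉V₁ v∈m)
          ... | inj₂ (inj₂ (inj₁ refl)) = ⊥-elim (disjoint b (v∈V₁ , b∈V₂))
          ... | inj₂ (inj₂ (inj₂ v∈t))  =
            -- Dropping `b` from the arc back to `a` leaves `t`, in which `b` does not recur.
            arc-AU b∉ (proj₂ (chain-tail (proj₂ arcs))) v∈t (firstHit-K p⟶s₁ v∈V₁)
              (All.map ≢-sym (unique-after (a ∷ m) unique))

        AU-b : AU _⟶_ (_≢ a) (_≡ b) s₂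
        AU-b = AU-enter a∉ (recurrent-branch p⟶s₂) (from ∘ ⇝⇒firstHit)
          where
          a∉ : ∀ {u} → u ∉ Vp → u ≢ a
          a∉ u∉Vp refl = u∉Vp (proj₁ a∈K)

          from : ∀ {v} → v ∈ V₂ → AU _⟶_ (_≢ a) (_≡ b) v
          from v∈V₂ with position (firstHit-K p⟶s₂ v∈V₂)
          ... | inj₁ refl              = ⊥-elim (disjoint a (a∈V₁ , v∈V₂))
          ... | inj₂ (inj₁ v∈m)        =
            arc-AU a∉ (proj₂ (chain-tail (proj₁ arcs))) v∈m (firstHit-K p⟶s₂ v∈V₂)
              (All.map ≢-sym (All.++⁻ˡ m a≢rest))
          ... | inj₂ (inj₂ (inj₁ v≡b)) = here v≡b
          ... | inj₂ (inj₂ (inj₂ v∈t)) = contradiction v∈V₂ (t∉V₂ v∈t)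

theorem4p14 :
    (G : CFG) (p s₁ s₂ : Node G) →
    PredicateNode G p s₁ s₂ →
    (∃₂ λ x y → x ≢ y × edges (A[_] G p) p x × edges (A[_] G p) p y) →
    let V₁ = FirstHit G p s₁
        V₂ = FirstHit G p s₂
        U  = V[_] G p ∖ (V₁ ∪ V₂)
    in
    Empty (V₁ ∩ V₂) →
    (∃₂ λ a b → DOD G p s₁ s₂ a b)
      ⇔
    (∃ λ w → Unfolding (C[_] G p) w ×
       toList w ∈ (⟦ V₁ ⟧ · ⟦ U ⟧ ⋆ · (⟦ V₂ ⟧ · ⟦ U ⟧ ⋆) ⋆ · ⟦ V₂ ⟧ · ⟦ U ⟧ ⋆ · (⟦ V₁ ⟧ · ⟦ U ⟧ ⋆) ⋆))
theorem4p14 G p s₁ s₂ branches@(_ , p⟶s₁ , p⟶s₂ , _) (_ , _ , x≢y , px , py) disjoint =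
  mk⇔ (λ (_ , _ , dod) → DOD⇒separated dod) (separated⇒DOD branches)
  where
  open Cycle G p x≢y (interval⇒R G p px) (interval⇒R G p py)
  open Branches p⟶s₁ p⟶s₂ disjoint
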